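{- For every positive integer $s$, as formal power series in $y$, \[ FL_{2}(s,y)=\frac{P_s(y)}{Q_s(y)} . \]
   Context: Definition of the counting function. The pseudo-line graph $L_{n,2}$ has $n$ vertices $v_1,\dots,v_n$ in a line, with edges joining consecutive vertices, one dangling (half-)edge at each of the two ends $v_1$ and $v_n$, and $2$ self-loops at each vertex. A magic labelling with magic sum $s$ assigns a nonnegative integer to each edge (including loops and dangling edges) so that at each vertex the labels of incident edges (each loop counted once) sum to $s$. Explicitly, for $n\ge 1$ and $s\in\mathbb{N}$, $h_{L_{n,2}}(s)$ is the number of nonnegative integer tuples $(\beta_1,\dots,\beta_{n+1};\alpha_{i,1},\alpha_{i,2}\ (1\le i\le n))$ with $\beta_i+\alpha_{i,1}+\alpha_{i,2}+\beta_{i+1}=s$ for all $1\le i\le n$; equivalently, it is the number of $(x_1,\dots,x_{2n+1})\in\mathbb{N}^{2n+1}$ with $x_{2i-1}+x_{2i}+x_{2i+1}\le s$ for $i=1,\dots,n$. By convention $h_{L_{0,2}}(s)=s+1$. Set \[ FL_2(s,y)=\sum_{n=0}^{\infty}h_{L_{n,2}}(s)\,y^n . \] Definition of the polynomials. For $n\ge 4$, \[ P_n(y)=-y[P_{n-1}(-y)+P_{n-3}(-y)]+2P_{n-2}(y)-P_{n-4}(y), \] \[ Q_n(y)=-y[Q_{n-1}(-y)+Q_{n-3}(-y)]+2Q_{n-2}(y)-Q_{n-4}(y), \] with initial values $P_0(y)=1$, $P_1(y)=2$, $P_2(y)=3-2y$, $P_3(y)=4-4y-2y^2$, and $Q_0(y)=1-y$,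 $Q_1(y)=1-2y-y^2$, $Q_2(y)=1-4y-2y^2+y^3$, $Q_3(y)=1-6y-7y^2+2y^3+y^4$. -}

module Defs where

open import Algebra.Properties.Semiring.Sum using (sum)
open import Data.Fin.Base using (Fin; zero; suc; toℕ; inject₁)
open import Data.Fin.Properties using (all?)
open import Data.Integer.Base as ℤ using (ℤ; +_; -_; 0ℤ; 1ℤ)
open import Data.Integer.Properties using (+-*-semiring)
open import Data.List.Base
  using (List; []; _∷_; length; filter; map; upTo; cartesianProduct; cartesianProductWith)
open import Data.List.Membership.Propositional using (_∈_)
open import Data.List.Membership.Propositional.Properties
  using (∈-filter⁺; ∈-filter⁻; ∈-upTo⁺; ∈-cartesianProduct⁺; ∈-cartesianProductWith⁺)
open import Data.List.Relation.Unary.All using ([])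
open import Data.List.Relation.Unary.AllPairs using ([]; _∷_)
open import Data.List.Relation.Unary.Any using (here)
open import Data.List.Relation.Unary.Unique.Propositional using (Unique)
open import Data.List.Relation.Unary.Unique.Propositional.Properties
  using (filter⁺; upTo⁺; cartesianProduct⁺; cartesianProductWith⁺)
open import Data.Nat.Base using (ℕ; zero; suc; _+_; _∸_; _≤_; s≤s)
import Data.Nat.Properties as ℕ
open import Data.Product.Base using (∃; _×_; _,_; proj₁; proj₂)
open import Data.Vec.Base using (Vec; []; _∷_; lookup)
open import Data.Vec.Properties using (∷-injective)
open import Function.Bundles using (_⇔_; mk⇔)
open import Relation.Binary.PropositionalEquality using (_≡_; refl; subst)
open import Relation.Nullary.Decidable.Core using (Dec)

------------------------------------------------------------------------
-- Magic labellings of the pseudo-line graph L_{n,2}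

-- (β , α): with vertices indexed by Fin n, the edges β i and β (i+1) are the
-- ones to the left and right of vertex i, so β has the two dangling edges as
-- its first and last entries; α i holds the labels of the two loops at i.
Labelling : ℕ → Set
Labelling n = Vec ℕ (suc n) × Vec (ℕ × ℕ) n

vertexSum : ∀ {n} → Labelling n → Fin n → ℕ
vertexSum (β , α) i =
  lookup β (inject₁ i) + proj₁ (lookup α i) + proj₂ (lookup α i) + lookup β (suc i)

IsMagic : ∀ {n} → ℕ → Labelling n → Set
IsMagic s l = ∀ i → vertexSum l i ≡ s

isMagic? : ∀ {n} s (l : Labelling n) → Dec (IsMagic s l)
isMagic? s l = all? (λ i → vertexSum l i ℕ.≟ s)

vectors : ∀ {A : Set} → List A → ∀ n → List (Vec A n)
vectors xs zero    = [] ∷ []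
vectors xs (suc n) = cartesianProductWith _∷_ xs (vectors xs n)

boundedLabellings : ∀ n → ℕ → List (Labelling n)
boundedLabellings n s =
  cartesianProduct (vectors (upTo (suc s)) (suc n))
                   (vectors (cartesianProduct (upTo (suc s)) (upTo (suc s))) n)

-- For n ≥ 1 every edge meets a vertex, so a label never exceeds s and the
-- search among labels ≤ s misses nothing: see ∈-magicLabellings and
-- magicLabellings-unique.
magicLabellings : ∀ n → ℕ → List (Labelling n)
magicLabellings n s = filter (isMagic? s) (boundedLabellings n s)

-- h n s is h_{L_{n,2}}(s); its value at n = 0 is a convention.
h : ℕ → ℕ → ℕ
h zero      s = suc s
h n@(suc _) s = length (magicLabellings n s)

vectors-unique : ∀ {A : Set} {xs : List A} → Unique xs → ∀ n → Unique (vectors xs n)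
vectors-unique u zero    = [] ∷ []
vectors-unique u (suc n) = cartesianProductWith⁺ _∷_ ∷-injective u (vectors-unique u n)

∈-vectors : ∀ {A : Set} {xs : List A} {n} (v : Vec A n) →
            (∀ i → lookup v i ∈ xs) → v ∈ vectors xs n
∈-vectors []      _ = here refl
∈-vectors (x ∷ v) p = ∈-cartesianProductWith⁺ _∷_ (p zero) (∈-vectors v (λ i → p (suc i)))

magicLabellings-unique : ∀ n s → Unique (magicLabellings n s)
magicLabellings-unique n s =
  filter⁺ (isMagic? s)
    (cartesianProduct⁺ (vectors-unique u (suc n)) (vectors-unique (cartesianProduct⁺ u u) n))
  where u = upTo⁺ (suc s)

∈-magicLabellings : ∀ n s (l : Labelling (suc n)) →
                    l ∈ magicLabellings (suc n) s ⇔ IsMagic s l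
∈-magicLabellings n s l@(β , α) = mk⇔
  (λ l∈ → proj₂ (∈-filter⁻ (isMagic? s) {xs = boundedLabellings (suc n) s} l∈))
  (λ m → ∈-filter⁺ (isMagic? s)
    (∈-cartesianProduct⁺
      (∈-vectors β (λ { zero    → small (subst (_ ≤_) (m zero) (first _ _ _ _))
                      ; (suc i) → small (subst (_ ≤_) (m i) (ℕ.m≤n+m _ _)) }))
      (∈-vectors α (λ i → ∈-cartesianProduct⁺
        (small (subst (_ ≤_) (m i) (second (lookup β (inject₁ i)) _ _ _)))
        (small (subst (_ ≤_) (m i) (third (lookup β (inject₁ i)) _ _ _))))))
    m)
  where
  small : ∀ {x} → x ≤ s → x ∈ upTo (suc s)
  small x≤s = ∈-upTo⁺ (s≤s x≤s)

  first : ∀ a b c d → a ≤ a + b + c + d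
  first a b c d = ℕ.≤-trans (ℕ.m≤m+n a b) (ℕ.≤-trans (ℕ.m≤m+n _ c) (ℕ.m≤m+n _ d))

  second : ∀ a b c d → b ≤ a + b + c + d
  second a b c d = ℕ.≤-trans (ℕ.m≤n+m b a) (ℕ.≤-trans (ℕ.m≤m+n _ c) (ℕ.m≤m+n _ d))

  third : ∀ a b c d → c ≤ a + b + c + d
  third a b c d = ℕ.≤-trans (ℕ.m≤n+m c (a + b)) (ℕ.m≤m+n _ d)

------------------------------------------------------------------------
-- Formal power series over ℤ, as coefficient sequences

PowerSeries : Set
PowerSeries = ℕ → ℤ

infix  4 _≈_ _≈_÷_
infixl 7 _⊛_

_≈_ : PowerSeries → PowerSeries → Set
f ≈ g = ∀ n → f n ≡ g n

_⊛_ : PowerSeries → PowerSeries → PowerSeries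
(f ⊛ g) n = sum +-*-semiring {suc n} (λ k → f (toℕ k) ℤ.* g (n ∸ toℕ k))

one : PowerSeries
one zero    = 1ℤ
one (suc _) = 0ℤ

-- The denominator is required to be invertible, so that the quotient makes
-- sense in ℤ[[y]] and is unique.
_≈_÷_ : PowerSeries → PowerSeries → PowerSeries → Set
f ≈ p ÷ q = ∃ λ q⁻¹ → (q ⊛ q⁻¹ ≈ one) × (f ≈ p ⊛ q⁻¹)

FL : ℕ → PowerSeries
FL s n = + h n s

------------------------------------------------------------------------
-- Polynomials over ℤ, as coefficient lists with the constant term first.
-- Trailing zeros are allowed, so polynomials are only compared as series.

Poly : Set
Poly = List ℤ

⟦_⟧ : Poly → PowerSeries
⟦ []    ⟧ _       = 0ℤ
⟦ a ∷ p ⟧ zero    = a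
⟦ a ∷ p ⟧ (suc n) = ⟦ p ⟧ n

infixl 6 _⊕_
infixr 7 _·_
infixr 8 y*_

_⊕_ : Poly → Poly → Poly
[]      ⊕ q       = q
(a ∷ p) ⊕ []      = a ∷ p
(a ∷ p) ⊕ (b ∷ q) = (a ℤ.+ b) ∷ (p ⊕ q)

_·_ : ℤ → Poly → Poly
c · p = map (c ℤ.*_) p

y*_ : Poly → Poly
y* p = 0ℤ ∷ p

-- p(y) ↦ p(-y), using (a + y p(y))(-y) = a - y p(-y).
_[-y] : Poly → Poly
[]      [-y] = []
(a ∷ p) [-y] = a ∷ (- 1ℤ) · (p [-y])

recurrence : (p₁ p₂ p₃ p₄ : Poly) → Poly
recurrence p₁ p₂ p₃ p₄ =
  (- 1ℤ) · y* (p₁ [-y] ⊕ p₃ [-y]) ⊕ (+ 2) · p₂ ⊕ (- 1ℤ) · p₄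

P : ℕ → Poly
P 0 = + 1 ∷ []
P 1 = + 2 ∷ []
P 2 = + 3 ∷ - + 2 ∷ []
P 3 = + 4 ∷ - + 4 ∷ - + 2 ∷ []
P (suc (suc (suc (suc n)))) =
  recurrence (P (suc (suc (suc n)))) (P (suc (suc n))) (P (suc n)) (P n)

Q : ℕ → Poly
Q 0 = + 1 ∷ - + 1 ∷ []
Q 1 = + 1 ∷ - + 2 ∷ - + 1 ∷ []
Q 2 = + 1 ∷ - + 4 ∷ - + 2 ∷ + 1 ∷ []
Q 3 = + 1 ∷ - + 6 ∷ - + 7 ∷ + 2 ∷ + 1 ∷ []
Q (suc (suc (suc (suc n)))) =
  recurrence (Q (suc (suc (suc n)))) (Q (suc (suc n))) (Q (suc n)) (Q n)

{-# OPTIONS --safe #-}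
module Submission where

-- Labellings are counted by transfer: if Uₐ is the generating function of those
-- whose first dangling edge is labelled a, and S denotes prefix sums, then
-- FL = S U s and, for a + c = s, Uₐ = 1 + y S(S U) c. The equations
-- wₐ = q + y S(S w) c say that the second difference of c ↦ w (s - c) is y w, so a
-- solution splits into a part symmetric and a part antisymmetric about the
-- centre, satisfying linear recurrences with characteristic polynomials
-- λ² - (2 ± y) λ + 1. The symmetric solutions are values of E at y, the
-- antisymmetric ones values of G at -y (E and G as below); the combination whose
-- boundary value q is 2 Q_s has total S w s = 2 P_s. The fixed point being unique, 2 Q_s FL = 2 P_s.

open import Defs
open import Algebra.Bundles using (CommutativeRing)
import Algebra.Construct.Pointwise as Pointwise
import Algebra.Properties.Group
import Algebra.Solver.Ring
open import Algebra.Solver.Ring.AlmostCommutativeRing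
  using (fromCommutativeRing; _-Raw-AlmostCommutative⟶_)
open import Data.Bool.Base using (Bool; true; false; if_then_else_)
open import Data.Fin.Base using (zero; suc)
open import Data.Integer.Base as ℤ using (ℤ; 0ℤ; 1ℤ)
import Data.Integer.Properties as ℤ
import Data.Integer.Solver as ℤ
open import Data.List.Base as List
  using (List; []; _∷_; _++_; length; filter; upTo; cartesianProduct; cartesianProductWith)
open import Data.List.Properties
  using (map-++; map-∘; map-cong; map-upTo; map-applyUpTo; applyUpTo-∷ʳ)
open import Data.Maybe.Base using (Maybe; just; nothing)
open import Data.Nat.Base as ℕ using (ℕ; zero; suc; z≤n; s≤s; _≤_; _≡ᵇ_; _<ᵇ_; NonZero)
open import Data.Nat.ListAction using (sum)
open import Data.Nat.ListAction.Properties using (sum-++)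
import Data.Nat.Properties as ℕ
import Data.Nat.Solver as ℕ
open import Data.Product.Base using (_×_; _,_; proj₁; proj₂)
open import Data.Vec.Base using (Vec; []; _∷_)
open import Function.Base using (_∘_)
open import Level using (0ℓ; _⊔_)
open import Relation.Binary.PropositionalEquality
  using (_≡_; refl; sym; trans; cong; cong₂; module ≡-Reasoning)
open import Relation.Nullary.Decidable.Core using (Dec; does; yes; no)
open import Relation.Nullary.Negation.Core using (contradiction)

-- Prefix sums for an arbitrary operation.

prefixSums : ∀ {a} {A : Set a} → (A → A → A) → (ℕ → A) → ℕ → A
prefixSums _∙_ f zero    = f 0
prefixSums _∙_ f (suc c) = prefixSums _∙_ f c ∙ f (suc c)

prefixSums-homo : ∀ {A B : Set} (_∙_ : A → A → A) (_◦_ : B → B → B) (φ : A → B) →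
  (∀ x x′ → φ (x ∙ x′) ≡ φ x ◦ φ x′) →
  ∀ f c → φ (prefixSums _∙_ f c) ≡ prefixSums _◦_ (λ a → φ (f a)) c
prefixSums-homo _∙_ _◦_ φ homo f zero    = refl
prefixSums-homo _∙_ _◦_ φ homo f (suc c) =
  trans (homo _ _) (cong (λ z → z ◦ φ (f (suc c))) (prefixSums-homo _∙_ _◦_ φ homo f c))

prefixSums-cong : ∀ {A : Set} {_∙_ : A → A → A} {f g : ℕ → A} c →
  (∀ b → b ≤ c → f b ≡ g b) → prefixSums _∙_ f c ≡ prefixSums _∙_ g c
prefixSums-cong zero    f≗g = f≗g 0 z≤n
prefixSums-cong {_∙_ = _∙_} (suc c) f≗g =
  cong₂ _∙_ (prefixSums-cong c (λ b b≤c → f≗g b (ℕ.m≤n⇒m≤1+n b≤c))) (f≗g (suc c) ℕ.≤-refl)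

-- Counting labellings vertex by vertex.

module Counting where

  open import Data.Nat.Base using (_+_; _*_; _∸_)

  private variable A B C : Set

  ∑ : List A → (A → ℕ) → ℕ
  ∑ xs f = sum (List.map f xs)

  ∑-cong : ∀ {f g : A → ℕ} → (∀ x → f x ≡ g x) → ∀ xs → ∑ xs f ≡ ∑ xs g
  ∑-cong f≗g xs = cong sum (map-cong f≗g xs)

  ∑-zero : ∀ (xs : List A) → ∑ xs (λ _ → 0) ≡ 0
  ∑-zero []       = refl
  ∑-zero (x ∷ xs) = ∑-zero xs

  ∑-+ : ∀ (f g : A → ℕ) xs → ∑ xs (λ x → f x + g x) ≡ ∑ xs f + ∑ xs g
  ∑-+ f g []       = refl
  ∑-+ f g (x ∷ xs) = trans (cong (f x + g x +_) (∑-+ f g xs))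
    (ℕ.+-*-Solver.solve 4 (λ a b c d → (a :+ b) :+ (c :+ d) := (a :+ c) :+ (b :+ d)) refl
      (f x) (g x) (∑ xs f) (∑ xs g))
    where open ℕ.+-*-Solver

  ∑-*ˡ : ∀ k (f : A → ℕ) xs → ∑ xs (λ x → k * f x) ≡ k * ∑ xs f
  ∑-*ˡ k f []       = sym (ℕ.*-zeroʳ k)
  ∑-*ˡ k f (x ∷ xs) =
    trans (cong (k * f x +_) (∑-*ˡ k f xs)) (sym (ℕ.*-distribˡ-+ k (f x) _))

  ∑-*ʳ : ∀ k (f : A → ℕ) xs → ∑ xs (λ x → f x * k) ≡ ∑ xs f * k
  ∑-*ʳ k f xs = trans (∑-cong (λ x → ℕ.*-comm (f x) k) xs)
    (trans (∑-*ˡ k f xs) (ℕ.*-comm k _))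

  ∑-cartesianProductWith : ∀ (g : A → B → C) (f : C → ℕ) xs ys →
    ∑ (cartesianProductWith g xs ys) f ≡ ∑ xs (λ x → ∑ ys (λ y → f (g x y)))
  ∑-cartesianProductWith g f []       ys = refl
  ∑-cartesianProductWith g f (x ∷ xs) ys = begin
    ∑ (List.map (g x) ys ++ cartesianProductWith g xs ys) f
      ≡⟨ cong sum (map-++ f (List.map (g x) ys) _) ⟩
    sum (List.map f (List.map (g x) ys) ++ List.map f (cartesianProductWith g xs ys))
      ≡⟨ sum-++ (List.map f (List.map (g x) ys)) _ ⟩
    ∑ (List.map (g x) ys) f + ∑ (cartesianProductWith g xs ys) f
      ≡⟨ cong₂ _+_ (cong sum (sym (map-∘ ys))) (∑-cartesianProductWith g f xs ys) ⟩
    ∑ ys (λ y → f (g x y)) + ∑ xs (λ x → ∑ ys (λ y → f (g x y))) ∎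
    where open ≡-Reasoning

  ⟪_⟫ : Bool → ℕ
  ⟪ b ⟫ = if b then 1 else 0

  length-filter : ∀ {P : A → Set} (P? : ∀ x → Dec (P x)) xs →
                  length (filter P? xs) ≡ ∑ xs (λ x → ⟪ does (P? x) ⟫)
  length-filter P? []       = refl
  length-filter P? (x ∷ xs) with does (P? x)
  ... | true  = cong suc (length-filter P? xs)
  ... | false = length-filter P? xs

  ∑-upTo-suc : ∀ n (f : ℕ → ℕ) → ∑ (upTo (suc n)) f ≡ f 0 + ∑ (upTo n) (f ∘ suc)
  ∑-upTo-suc n f = cong (f 0 +_)
    (cong sum (trans (map-applyUpTo suc f n) (sym (map-upTo (f ∘ suc) n))))

  -- The only candidate `q = c - i` exists when `i ≤ c`, and `c ≤ N` keeps it in range.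
  count-≡ : ∀ N c i → c ≤ N → ∑ (upTo (suc N)) (λ q → ⟪ q + i ≡ᵇ c ⟫) ≡ ⟪ i <ᵇ suc c ⟫
  count-≡ zero    zero    zero    _ = refl
  count-≡ zero    zero    (suc i) _ = refl
  count-≡ (suc N) zero    i       _ = trans (∑-upTo-suc (suc N) (λ q → ⟪ q + i ≡ᵇ 0 ⟫))
    (trans (cong (⟪ i ≡ᵇ 0 ⟫ +_) (∑-zero (upTo (suc N)))) (trans (ℕ.+-identityʳ _) (lemma i)))
    where
    lemma : ∀ i → ⟪ i ≡ᵇ 0 ⟫ ≡ ⟪ i <ᵇ 1 ⟫
    lemma zero    = refl
    lemma (suc i) = refl
  count-≡ (suc N) (suc c) i (s≤s p) = trans (∑-upTo-suc (suc N) (λ q → ⟪ q + i ≡ᵇ suc c ⟫))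
    (trans (cong (⟪ i ≡ᵇ suc c ⟫ +_) (count-≡ N c i p)) (lemma i (suc c)))
    where
    lemma : ∀ i c → ⟪ i ≡ᵇ c ⟫ + ⟪ i <ᵇ c ⟫ ≡ ⟪ i <ᵇ suc c ⟫
    lemma zero    zero    = refl
    lemma zero    (suc c) = refl
    lemma (suc i) zero    = refl
    lemma (suc i) (suc c) = lemma i c

  suc∸ : ∀ d b → (d ∸ b) + ⟪ b <ᵇ suc d ⟫ ≡ suc d ∸ b
  suc∸ d       zero    = ℕ.+-comm d 1
  suc∸ zero    (suc b) = sym (ℕ.0∸n≡0 b)
  suc∸ (suc d) (suc b) = suc∸ d b

  count-< : ∀ N d b → d ≤ N → ∑ (upTo N) (λ p → ⟪ p + b <ᵇ d ⟫) ≡ d ∸ b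
  count-< N       zero    b _ = trans (∑-zero (upTo N)) (sym (ℕ.0∸n≡0 b))
  count-< (suc N) (suc d) b (s≤s p) = trans (∑-upTo-suc N _)
    (trans (cong (⟪ b <ᵇ suc d ⟫ +_) (count-< N d b p))
      (trans (ℕ.+-comm ⟪ b <ᵇ suc d ⟫ _) (suc∸ d b)))

  ∑-<ᵇ : ∀ N d f → d ≤ N → ∑ (upTo N) (λ b → ⟪ b <ᵇ d ⟫ * f b) ≡ ∑ (upTo d) f
  ∑-<ᵇ N       zero    f _       = ∑-zero (upTo N)
  ∑-<ᵇ (suc N) (suc d) f (s≤s p) = trans (∑-upTo-suc N _)
    (trans (cong₂ _+_ (ℕ.+-identityʳ (f 0)) (∑-<ᵇ N d (f ∘ suc) p)) (sym (∑-upTo-suc d f)))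

  ∑-upTo≡prefixSums : ∀ f c → ∑ (upTo (suc c)) f ≡ prefixSums _+_ f c
  ∑-upTo≡prefixSums f zero    = ℕ.+-identityʳ (f 0)
  ∑-upTo≡prefixSums f (suc c) = begin
    ∑ (upTo (suc (suc c))) f
      ≡⟨ cong (λ xs → ∑ xs f) (applyUpTo-∷ʳ (λ x → x) (suc c)) ⟨
    ∑ (upTo (suc c) ++ suc c ∷ []) f
      ≡⟨ cong sum (map-++ f (upTo (suc c)) _) ⟩
    sum (List.map f (upTo (suc c)) ++ f (suc c) ∷ [])
      ≡⟨ sum-++ (List.map f (upTo (suc c))) _ ⟩
    ∑ (upTo (suc c)) f + (f (suc c) + 0)
      ≡⟨ cong₂ _+_ (∑-upTo≡prefixSums f c) (ℕ.+-identityʳ _) ⟩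
    prefixSums _+_ f (suc c) ∎
    where open ≡-Reasoning

  -- `suc c ∸ b` counts the `j` with `b ≤ j ≤ c`, hence the occurrences of `f b` in the double sum.
  -- Raising `c` by one adds the indicator of `b ≤ suc c` to the weight and so one more prefix sum
  -- to the total.
  ∑-∸ : ∀ N f c → c ≤ N →
        ∑ (upTo (suc N)) (λ b → (suc c ∸ b) * f b) ≡ prefixSums _+_ (prefixSums _+_ f) c
  ∑-∸ N f zero    p = trans
    (∑-cong (λ b → cong (_* f b) (lemma b)) (upTo (suc N)))
    (trans (∑-<ᵇ (suc N) 1 f (s≤s p)) (ℕ.+-identityʳ (f 0)))
    where
    lemma : ∀ b → 1 ∸ b ≡ ⟪ b <ᵇ 1 ⟫
    lemma zero    = refl
    lemma (suc b) = ℕ.0∸n≡0 b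
  ∑-∸ N f (suc c) p = begin
    ∑ (upTo (suc N)) (λ b → (suc (suc c) ∸ b) * f b)
      ≡⟨ ∑-cong (λ b → trans (cong (_* f b) (sym (suc∸ (suc c) b)))
                             (ℕ.*-distribʳ-+ (f b) (suc c ∸ b) _)) (upTo (suc N)) ⟩
    ∑ (upTo (suc N)) (λ b → (suc c ∸ b) * f b + ⟪ b <ᵇ suc (suc c) ⟫ * f b)
      ≡⟨ ∑-+ (λ b → (suc c ∸ b) * f b) _ (upTo (suc N)) ⟩
    ∑ (upTo (suc N)) (λ b → (suc c ∸ b) * f b) + ∑ (upTo (suc N)) (λ b → ⟪ b <ᵇ suc (suc c) ⟫ * f b)
      ≡⟨ cong₂ _+_ (∑-∸ N f c (ℕ.<⇒≤ p))
           (trans (∑-<ᵇ (suc N) (suc (suc c)) f (s≤s p)) (∑-upTo≡prefixSums f (suc c))) ⟩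
    prefixSums _+_ (prefixSums _+_ f) (suc c) ∎
    where open ≡-Reasoning

  -- For `n = 0` there is no vertex condition and the value is 1 for every `a`; this becomes the
  -- constant term of the fixed-point equations.
  startingWith : ℕ → ℕ → ℕ → ℕ
  startingWith s n a =
    ∑ (vectors (upTo (suc s)) n) λ β →
    ∑ (vectors (cartesianProduct (upTo (suc s)) (upTo (suc s))) n) λ α →
    ⟪ does (isMagic? s (a ∷ β , α)) ⟫

  does-× : (d : Dec A) (e : Dec B) (f : Dec C) → (A → B × C) → (B → C → A) →
           ⟪ does d ⟫ ≡ ⟪ does e ⟫ * ⟪ does f ⟫
  does-× (yes a) (yes b) (yes c) to from = refl
  does-× (yes a) (no ¬b) f       to from = contradiction (proj₁ (to a)) ¬b
  does-× (yes a) (yes b) (no ¬c) to from = contradiction (proj₂ (to a)) ¬c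
  does-× (no ¬a) (yes b) (yes c) to from = contradiction (from b c) ¬a
  does-× (no ¬a) (yes b) (no ¬c) to from = refl
  does-× (no ¬a) (no ¬b) f       to from = refl

  does-isMagic? : ∀ {n} s a b p q (β : Vec ℕ n) α →
    ⟪ does (isMagic? s (a ∷ b ∷ β , (p , q) ∷ α)) ⟫ ≡
    ⟪ a + p + q + b ≡ᵇ s ⟫ * ⟪ does (isMagic? s (b ∷ β , α)) ⟫
  does-isMagic? s a b p q β α = does-×
    (isMagic? s (a ∷ b ∷ β , (p , q) ∷ α)) (a + p + q + b ℕ.≟ s) (isMagic? s (b ∷ β , α))
    (λ m → m zero , λ i → m (suc i))
    (λ { m₀ m zero → m₀ ; m₀ m (suc i) → m i })

  ≡ᵇ-cancelˡ : ∀ a m n → (a + m ≡ᵇ a + n) ≡ (m ≡ᵇ n)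
  ≡ᵇ-cancelˡ zero    m n = refl
  ≡ᵇ-cancelˡ (suc a) m n = ≡ᵇ-cancelˡ a m n

  -- Cancelling `a` leaves `p + q + b = c`: `q` is determined by `p`, and `p` ranges over
  -- `0, …, c - b`.
  count-loops : ∀ a c b → ∑ (upTo (suc (a + c))) (λ p → ∑ (upTo (suc (a + c))) λ q →
    ⟪ a + p + q + b ≡ᵇ a + c ⟫) ≡ suc c ∸ b
  count-loops a c b = begin
    ∑ xs (λ p → ∑ xs λ q → ⟪ a + p + q + b ≡ᵇ a + c ⟫)
      ≡⟨ ∑-cong (λ p → ∑-cong (λ q → cong ⟪_⟫ (trans
           (cong (_≡ᵇ (a + c)) (lemma p q)) (≡ᵇ-cancelˡ a (q + (p + b)) c))) xs) xs ⟩
    ∑ xs (λ p → ∑ xs λ q → ⟪ q + (p + b) ≡ᵇ c ⟫)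
      ≡⟨ ∑-cong (λ p → count-≡ (a + c) c (p + b) (ℕ.m≤n+m c a)) xs ⟩
    ∑ xs (λ p → ⟪ p + b <ᵇ suc c ⟫)
      ≡⟨ count-< (suc (a + c)) (suc c) b (s≤s (ℕ.m≤n+m c a)) ⟩
    suc c ∸ b ∎
    where
    open ≡-Reasoning
    xs = upTo (suc (a + c))
    lemma : ∀ p q → a + p + q + b ≡ a + (q + (p + b))
    lemma p q = ℕ.+-*-Solver.solve 4
      (λ a p q b → a :+ p :+ q :+ b := a :+ (q :+ (p :+ b))) refl a p q b
      where open ℕ.+-*-Solver

  -- The transfer step. A next edge labelled `b` admits `suc c ∸ b` pairs of loop labels at the
  -- first vertex, and these weights produce the double prefix sum.
  startingWith-suc : ∀ n a c → startingWith (a + c) (suc n) a ≡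
    prefixSums _+_ (prefixSums _+_ (startingWith (a + c) n)) c
  startingWith-suc n a c = begin
    ∑ (cartesianProductWith _∷_ xs (vectors xs n)) (λ β → ∑ (cartesianProductWith _∷_ xs² αs) λ α →
      ⟪ does (isMagic? s (a ∷ β , α)) ⟫)
      ≡⟨ ∑-cartesianProductWith _∷_ _ xs βs ⟩
    ∑ xs (λ b → ∑ βs λ β → ∑ (cartesianProductWith _∷_ xs² αs) λ α →
      ⟪ does (isMagic? s (a ∷ b ∷ β , α)) ⟫)
      ≡⟨ ∑-cong (λ b → ∑-cong (λ β → trans
           (∑-cartesianProductWith _∷_ _ xs² αs)
           (∑-cartesianProductWith _,_ _ xs xs)) βs) xs ⟩
    ∑ xs (λ b → ∑ βs λ β → ∑ xs λ p → ∑ xs λ q → ∑ αs λ α →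
      ⟪ does (isMagic? s (a ∷ b ∷ β , (p , q) ∷ α)) ⟫)
      -- The condition at the first vertex does not involve `α`, and the remaining conditions do not
      -- involve `p` and `q`, so the sum factors.
      ≡⟨ ∑-cong (λ b → ∑-cong (λ β → ∑-cong (λ p → ∑-cong (λ q → trans
           (∑-cong (does-isMagic? s a b p q β) αs) (∑-*ˡ (w b p q) _ αs)) xs) xs) βs) xs ⟩
    ∑ xs (λ b → ∑ βs λ β → ∑ xs λ p → ∑ xs λ q → w b p q * k b β)
      ≡⟨ ∑-cong (λ b → ∑-cong (λ β → trans
           (∑-cong (λ p → ∑-*ʳ (k b β) (w b p) xs) xs)
           (trans (∑-*ʳ (k b β) (λ p → ∑ xs (w b p)) xs)
             (cong (_* k b β) (count-loops a c b)))) βs) xs ⟩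
    ∑ xs (λ b → ∑ βs λ β → (suc c ∸ b) * k b β)
      ≡⟨ ∑-cong (λ b → ∑-*ˡ (suc c ∸ b) (k b) βs) xs ⟩
    ∑ xs (λ b → (suc c ∸ b) * startingWith s n b)
      ≡⟨ ∑-∸ s (startingWith s n) c (ℕ.m≤n+m c a) ⟩
    prefixSums _+_ (prefixSums _+_ (startingWith s n)) c ∎
    where
    open ≡-Reasoning
    s   = a + c
    xs  = upTo (suc s)
    xs² = cartesianProduct xs xs
    βs  = vectors xs n
    αs  = vectors xs² n
    w   = λ b p q → ⟪ a + p + q + b ≡ᵇ s ⟫
    k   = λ b β → ∑ αs λ α → ⟪ does (isMagic? s (b ∷ β , α)) ⟫

  h≡prefixSums : ∀ n s → h n s ≡ prefixSums _+_ (startingWith s n) s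
  -- The convention `h 0 s = s + 1` fits the transfer: each of the `s + 1` labels of the single edge
  -- counts once.
  h≡prefixSums zero s = lemma s
    where
    lemma : ∀ c → suc c ≡ prefixSums _+_ (startingWith s 0) c
    lemma zero    = refl
    lemma (suc c) = trans (cong suc (lemma c)) (ℕ.+-comm 1 _)
  h≡prefixSums n@(suc _) s = begin
    length (magicLabellings n s)
      ≡⟨ length-filter (isMagic? s) (boundedLabellings n s) ⟩
    ∑ (boundedLabellings n s) (λ l → ⟪ does (isMagic? s l) ⟫)
      ≡⟨ ∑-cartesianProductWith _,_ _ (vectors xs (suc n)) αs ⟩
    ∑ (vectors xs (suc n)) (λ β → ∑ αs λ α → ⟪ does (isMagic? s (β , α)) ⟫)
      ≡⟨ ∑-cartesianProductWith _∷_ _ xs (vectors xs n) ⟩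
    ∑ xs (startingWith s n)
      ≡⟨ ∑-upTo≡prefixSums (startingWith s n) s ⟩
    prefixSums _+_ (startingWith s n) s ∎
    where
    open ≡-Reasoning
    xs = upTo (suc s)
    αs = vectors (cartesianProduct xs xs) n

open import Data.Integer.Base using (+_)

-- The sequences `E` and `G`, and their relation to `P` and `Q`.

module Polynomials {c ℓ} (𝓡 : CommutativeRing c ℓ)
  (morphism : CommutativeRing.rawRing ℤ.+-*-commutativeRing -Raw-AlmostCommutative⟶
              fromCommutativeRing 𝓡)
  where

  private module R = CommutativeRing 𝓡
  open R using (Carrier; _+_; _*_; -_; setoid) renaming (_≈_ to _≋_)
  open Algebra.Properties.Group R.+-group using () renaming (⁻¹-involutive to -‿involutive)
  open _-Raw-AlmostCommutative⟶_ morphism using (+-homo; *-homo) renaming (⟦_⟧ to const)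

  const≟ : ∀ a b → Maybe (const a ≋ const b)
  const≟ a b with a ℤ.≟ b
  ... | yes refl = just R.refl
  ... | no _     = nothing

  open Algebra.Solver.Ring
    (CommutativeRing.rawRing ℤ.+-*-commutativeRing) (fromCommutativeRing 𝓡) morphism
    const≟
    using (Polynomial; solve; _:=_; _:+_; _:*_; :-_; con)

  -- With u = (μ - 1/μ)², E u n is μⁿ + μ⁻ⁿ, divided by μ + 1/μ when n is odd, and
  -- G u n is μⁿ - μ⁻ⁿ, divided by μ - 1/μ, and also by μ + 1/μ when n is even.
  E G : Carrier → ℕ → Carrier
  E u zero          = const (+ 2)
  E u (suc zero)    = const (+ 1)
  E u (suc (suc n)) = E u n + u * G u (suc n)
  G u zero          = const (+ 0)
  G u (suc zero)    = const (+ 1)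
  G u (suc (suc n)) = G u n + E u (suc n)

  E-cong : ∀ {u v} → u ≋ v → ∀ n → E u n ≋ E v n
  G-cong : ∀ {u v} → u ≋ v → ∀ n → G u n ≋ G v n
  E-cong p zero          = R.refl
  E-cong p (suc zero)    = R.refl
  E-cong p (suc (suc n)) = R.+-cong (E-cong p n) (R.*-cong p (G-cong p (suc n)))
  G-cong p zero          = R.refl
  G-cong p (suc zero)    = R.refl
  G-cong p (suc (suc n)) = R.+-cong (G-cong p n) (E-cong p (suc n))

  -- For v = - u these are twice P_n and Q_n at u.
  2P 2Q : (u v : Carrier) → ℕ → Carrier
  2P u v n = E v (suc (suc n)) * G u n + G u (suc (suc n)) * E v n
  2Q u v n = E v (suc (suc n)) * E u (suc n) + - (u * (G u (suc (suc n)) * G v (suc n)))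

  -- Substituting `- y` for `y` exchanges `u` and `- u`, so `F (- u) u` stands for the polynomial at
  -- `- y`.
  Recurrence : (Carrier → Carrier → ℕ → Carrier) → Set (c ⊔ ℓ)
  Recurrence F = ∀ u n →
    F u (- u) (suc (suc (suc (suc n)))) ≋
    - (u * (F (- u) u (suc (suc (suc n))) + F (- u) u (suc n)))
      + const (+ 2) * F u (- u) (suc (suc n)) + - F u (- u) n

  -- Solver expressions: `e k` and `g k` stand for `E` and `G` at index `n + k`, unrolled from given
  -- values at `n` and `n + 1`.
  module Unrolled {m} (u e₀ e₁ g₀ g₁ : Polynomial m) where
    e g : ℕ → Polynomial m
    e 0 = e₀
    e 1 = e₁
    e (suc (suc n)) = e n :+ u :* g (suc n)
    g 0 = g₀
    g 1 = g₁
    g (suc (suc n)) = g n :+ e (suc n)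

    2p : (f : ℕ → Polynomial m) → ℕ → Polynomial m
    2p f n = f (suc (suc n)) :* g n :+ g (suc (suc n)) :* f n

    2q : (f h : ℕ → Polynomial m) → ℕ → Polynomial m
    2q f h n = f (suc (suc n)) :* e (suc n) :+ :- (u :* (g (suc (suc n)) :* h (suc n)))

  open Unrolled

  -- Expanded in the values of `E` and `G` at `n` and `suc n`, for both `u` and `- u`, the
  -- recurrence is a polynomial identity in nine independent variables.
  2P-rec : Recurrence 2P
  2P-rec u n =
    solve 9 (λ u e₀ e₁ g₀ g₁ f₀ f₁ h₀ h₁ →
      let a = 2p u e₀ e₁ g₀ g₁ (e (:- u) f₀ f₁ h₀ h₁)
          b = 2p (:- u) f₀ f₁ h₀ h₁ (e u e₀ e₁ g₀ g₁)
      in a 4 := :- (u :* (b 3 :+ b 1)) :+ con (+ 2) :* a 2 :+ :- a 0)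
    R.refl
    u (E u n) (E u (suc n)) (G u n) (G u (suc n))
    (E (- u) n) (E (- u) (suc n)) (G (- u) n) (G (- u) (suc n))

  2Q-rec : Recurrence 2Q
  2Q-rec u n =
    solve 9 (λ u e₀ e₁ g₀ g₁ f₀ f₁ h₀ h₁ →
      let a = 2q u e₀ e₁ g₀ g₁ (e (:- u) f₀ f₁ h₀ h₁) (g (:- u) f₀ f₁ h₀ h₁)
          b = 2q (:- u) f₀ f₁ h₀ h₁ (e u e₀ e₁ g₀ g₁) (g u e₀ e₁ g₀ g₁)
      in a 4 := :- (u :* (b 3 :+ b 1)) :+ con (+ 2) :* a 2 :+ :- a 0)
    R.refl
    u (E u n) (E u (suc n)) (G u n) (G u (suc n))
    (E (- u) n) (E (- u) (suc n)) (G (- u) n) (G (- u) (suc n))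

  eval : Poly → Carrier → Carrier
  eval []      u = const 0ℤ
  eval (a ∷ p) u = const a + u * eval p u

  eval-⊕ : ∀ p q u → eval (p ⊕ q) u ≋ eval p u + eval q u
  eval-⊕ []      q       u =
    solve 1 (λ b → b := con 0ℤ :+ b) R.refl (eval q u)
  eval-⊕ (a ∷ p) []      u =
    solve 1 (λ b → b := b :+ con 0ℤ) R.refl (eval (a ∷ p) u)
  eval-⊕ (a ∷ p) (b ∷ q) u = R.trans
    (R.+-cong (+-homo a b) (R.*-congˡ (eval-⊕ p q u)))
    (solve 5 (λ a b u p q → a :+ b :+ u :* (p :+ q) := a :+ u :* p :+ (b :+ u :* q))
      R.refl (const a) (const b) u (eval p u) (eval q u))

  eval-· : ∀ c p u → eval (c · p) u ≋ const c * eval p u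
  eval-· c []      u = solve 1 (λ c → con 0ℤ := c :* con 0ℤ) R.refl (const c)
  eval-· c (a ∷ p) u = R.trans
    (R.+-cong (*-homo c a) (R.*-congˡ (eval-· c p u)))
    (solve 4 (λ c a u p → c :* a :+ u :* (c :* p) := c :* (a :+ u :* p))
      R.refl (const c) (const a) u (eval p u))

  eval-[-y] : ∀ p u → eval (p [-y]) u ≋ eval p (- u)
  eval-[-y] []      u = R.refl
  eval-[-y] (a ∷ p) u = R.trans
    (R.+-congˡ (R.*-congˡ
      (R.trans (eval-· (ℤ.- 1ℤ) (p [-y]) u) (R.*-congˡ (eval-[-y] p u)))))
    (solve 3 (λ a u p → a :+ u :* (con (ℤ.- 1ℤ) :* p) := a :+ (:- u) :* p)
      R.refl (const a) u (eval p (- u)))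

  eval-recurrence : ∀ p₁ p₂ p₃ p₄ u →
    eval (recurrence p₁ p₂ p₃ p₄) u ≋
    - (u * (eval p₁ (- u) + eval p₃ (- u))) + const (+ 2) * eval p₂ u + - eval p₄ u
  eval-recurrence p₁ p₂ p₃ p₄ u = begin
    eval (recurrence p₁ p₂ p₃ p₄) u
      ≈⟨ eval-⊕ (p ⊕ + 2 · p₂) (ℤ.- 1ℤ · p₄) u ⟩
    eval (p ⊕ + 2 · p₂) u + eval (ℤ.- 1ℤ · p₄) u
      ≈⟨ R.+-cong (eval-⊕ p (+ 2 · p₂) u) (eval-· (ℤ.- 1ℤ) p₄ u) ⟩
    eval p u + eval (+ 2 · p₂) u + const (ℤ.- 1ℤ) * eval p₄ u
      ≈⟨ R.+-congʳ (R.+-cong (eval-· (ℤ.- 1ℤ) (y* (p₁ [-y] ⊕ p₃ [-y])) u) (eval-· (+ 2) p₂ u)) ⟩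
    const (ℤ.- 1ℤ) * (const 0ℤ + u * eval (p₁ [-y] ⊕ p₃ [-y]) u)
      + const (+ 2) * eval p₂ u + const (ℤ.- 1ℤ) * eval p₄ u
      ≈⟨ R.+-congʳ (R.+-congʳ (R.*-congˡ (R.+-congˡ (R.*-congˡ
           (R.trans (eval-⊕ (p₁ [-y]) (p₃ [-y]) u)
                     (R.+-cong (eval-[-y] p₁ u) (eval-[-y] p₃ u))))))) ⟩
    const (ℤ.- 1ℤ) * (const 0ℤ + u * (eval p₁ (- u) + eval p₃ (- u)))
      + const (+ 2) * eval p₂ u + const (ℤ.- 1ℤ) * eval p₄ u
      ≈⟨ solve 5 (λ u a b c d →
           con (ℤ.- 1ℤ) :* (con 0ℤ :+ u :* (a :+ b)) :+ con (+ 2) :* c :+ con (ℤ.- 1ℤ) :* d :=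
           :- (u :* (a :+ b)) :+ con (+ 2) :* c :+ :- d)
           R.refl u (eval p₁ (- u)) (eval p₃ (- u)) (eval p₂ u) (eval p₄ u) ⟩
    - (u * (eval p₁ (- u) + eval p₃ (- u))) + const (+ 2) * eval p₂ u + - eval p₄ u ∎
    where
    open import Relation.Binary.Reasoning.Setoid setoid
    p = (ℤ.- 1ℤ) · y* (p₁ [-y] ⊕ p₃ [-y])

  -- The quantifier over `u` serves the induction: the recurrence evaluates two of the preceding
  -- polynomials at `- u`.
  Doubles : (Carrier → Carrier → ℕ → Carrier) → (ℕ → Poly) → ℕ → Set (c ⊔ ℓ)
  Doubles F R n = ∀ u → const (+ 2) * eval (R n) u ≋ F u (- u) n

  module _ (F : Carrier → Carrier → ℕ → Carrier) (R : ℕ → Poly)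
    (F-cong : ∀ {u v v′} → v ≋ v′ → ∀ n → F u v n ≋ F u v′ n)
    (F-rec : Recurrence F)
    (R-rec : ∀ n → R (suc (suc (suc (suc n)))) ≡
             recurrence (R (suc (suc (suc n)))) (R (suc (suc n))) (R (suc n)) (R n))
    where

    doubles-step : ∀ n → Doubles F R n → Doubles F R (suc n) → Doubles F R (suc (suc n)) →
      Doubles F R (suc (suc (suc n))) → Doubles F R (suc (suc (suc (suc n))))
    doubles-step n d₀ d₁ d₂ d₃ u = begin
      const (+ 2) * eval (R (suc (suc (suc (suc n))))) u
        ≈⟨ R.*-congˡ (R.trans (R.reflexive (cong (λ r → eval r u) (R-rec n)))
             (eval-recurrence (R (suc (suc (suc n)))) (R (suc (suc n))) (R (suc n)) (R n) u)) ⟩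
      const (+ 2) * (- (u * (r₃ + r₁)) + const (+ 2) * r₂ + - r₀)
        ≈⟨ solve 5 (λ u a b c d →
             con (+ 2) :* (:- (u :* (a :+ b)) :+ con (+ 2) :* c :+ :- d) :=
             :- (u :* (con (+ 2) :* a :+ con (+ 2) :* b))
               :+ con (+ 2) :* (con (+ 2) :* c) :+ :- (con (+ 2) :* d))
             R.refl u r₃ r₁ r₂ r₀ ⟩
      - (u * (const (+ 2) * r₃ + const (+ 2) * r₁))
        + const (+ 2) * (const (+ 2) * r₂) + - (const (+ 2) * r₀)
        ≈⟨ R.+-cong (R.+-cong (R.-‿cong (R.*-congˡ (R.+-cong (flip d₃) (flip d₁))))
             (R.*-congˡ (d₂ u))) (R.-‿cong (d₀ u)) ⟩
      - (u * (F (- u) u (suc (suc (suc n))) + F (- u) u (suc n)))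
        + const (+ 2) * F u (- u) (suc (suc n)) + - F u (- u) n
        ≈⟨ F-rec u n ⟨
      F u (- u) (suc (suc (suc (suc n)))) ∎
      where
      open import Relation.Binary.Reasoning.Setoid setoid
      r₀ = eval (R n) u
      r₁ = eval (R (suc n)) (- u)
      r₂ = eval (R (suc (suc n))) u
      r₃ = eval (R (suc (suc (suc n)))) (- u)

      -- The hypothesis at `- u` ends in `F (- u) (- (- u)) m`; `F-cong` removes the double
      -- negation.
      flip : ∀ {m} → Doubles F R m → const (+ 2) * eval (R m) (- u) ≋ F (- u) u m
      flip {m} d = R.trans (d (- u)) (F-cong (-‿involutive u) m)

    doubles : Doubles F R 0 → Doubles F R 1 → Doubles F R 2 → Doubles F R 3 → ∀ n → Doubles F R n
    doubles d₀ d₁ d₂ d₃ zero                      = d₀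
    doubles d₀ d₁ d₂ d₃ (suc zero)                = d₁
    doubles d₀ d₁ d₂ d₃ (suc (suc zero))          = d₂
    doubles d₀ d₁ d₂ d₃ (suc (suc (suc zero)))    = d₃
    doubles d₀ d₁ d₂ d₃ (suc (suc (suc (suc n)))) =
      doubles-step n (doubles d₀ d₁ d₂ d₃ n) (doubles d₀ d₁ d₂ d₃ (suc n))
        (doubles d₀ d₁ d₂ d₃ (suc (suc n))) (doubles d₀ d₁ d₂ d₃ (suc (suc (suc n))))

  :eval : ∀ {m} → Poly → Polynomial m → Polynomial m
  :eval []      u = con 0ℤ
  :eval (a ∷ p) u = con a :+ u :* :eval p u

  module _ {m} (u : Polynomial m) where
    :E :G : ℕ → Polynomial m
    :E = e u (con (+ 2)) (con (+ 1)) (con (+ 0)) (con (+ 1))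
    :G = g u (con (+ 2)) (con (+ 1)) (con (+ 0)) (con (+ 1))

  -- Both sides obey the same recurrence of order four, so four initial identities in one variable
  -- suffice.
  2P-correct : ∀ n → Doubles 2P P n
  2P-correct = doubles 2P P
    (λ {u} p n → R.+-cong (R.*-congʳ (E-cong p (suc (suc n)))) (R.*-congˡ (E-cong p n)))
    2P-rec (λ _ → refl)
    (solve 1 (equation 0) R.refl) (solve 1 (equation 1) R.refl)
    (solve 1 (equation 2) R.refl) (solve 1 (equation 3) R.refl)
    where
    equation : ℕ → Polynomial 1 → _
    equation n u = con (+ 2) :* :eval (P n) u :=
      2p u (con (+ 2)) (con (+ 1)) (con (+ 0)) (con (+ 1)) (:E (:- u)) n

  2Q-correct : ∀ n → Doubles 2Q Q n
  2Q-correct = doubles 2Q Q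
    (λ {u} p n → R.+-cong (R.*-congʳ (E-cong p (suc (suc n))))
      (R.-‿cong (R.*-congˡ (R.*-congˡ (G-cong p (suc n))))))
    2Q-rec (λ _ → refl)
    (solve 1 (equation 0) R.refl) (solve 1 (equation 1) R.refl)
    (solve 1 (equation 2) R.refl) (solve 1 (equation 3) R.refl)
    where
    equation : ℕ → Polynomial 1 → _
    equation n u = con (+ 2) :* :eval (Q n) u :=
      2q u (con (+ 2)) (con (+ 1)) (con (+ 0)) (con (+ 1)) (:E (:- u)) (:G (:- u)) n

  -- E± u m n and G± u m n extend E and G to the index m - n, evenly and oddly.
  E± G± : Carrier → ℕ → ℕ → Carrier
  E± u m       zero    = E u m
  E± u zero    (suc n) = E u (suc n)
  E± u (suc m) (suc n) = E± u m n
  G± u m       zero    = G u m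
  G± u zero    (suc n) = - G u (suc n)
  G± u (suc m) (suc n) = G± u m n

  E±-zero : ∀ u n → E± u 0 n ≡ E u n
  E±-zero u zero    = refl
  E±-zero u (suc n) = refl

  G±-zero : ∀ u n → G± u 0 n ≋ - G u n
  G±-zero u zero    = solve 0 (con (+ 0) := :- con (+ 0)) R.refl
  G±-zero u (suc n) = R.refl

  E±-+ : ∀ u k m n → E± u (k ℕ.+ m) (k ℕ.+ n) ≡ E± u m n
  E±-+ u zero    m n = refl
  E±-+ u (suc k) m n = E±-+ u k m n

  G±-+ : ∀ u k m n → G± u (k ℕ.+ m) (k ℕ.+ n) ≡ G± u m n
  G±-+ u zero    m n = refl
  G±-+ u (suc k) m n = G±-+ u k m n

  E±-sym : ∀ u m n → E± u m n ≡ E± u n m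
  E±-sym u zero    zero    = refl
  E±-sym u zero    (suc n) = refl
  E±-sym u (suc m) zero    = refl
  E±-sym u (suc m) (suc n) = E±-sym u m n

  G±-antisym : ∀ u m n → G± u m n ≋ - G± u n m
  G±-antisym u m       zero    =
    R.trans (R.sym (-‿involutive (G u m))) (R.-‿cong (R.sym (G±-zero u m)))
  G±-antisym u zero    (suc n) = R.refl
  G±-antisym u (suc m) (suc n) = G±-antisym u m n

  -- The recurrence `E (k + 1) = E (k - 1) + u G k` persists at `k = m - n ≤ 0` because `E` is
  -- extended evenly and `G` oddly.
  E±-step : ∀ u m n → E± u (suc m) n ≋ E± u m (suc n) + u * G± u m n
  E±-step u zero    zero    =
    solve 1 (λ u → con (+ 1) := con (+ 1) :+ u :* con (+ 0)) R.refl u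
  E±-step u (suc m) zero    = R.refl
  E±-step u zero    (suc n) = R.trans (R.reflexive (E±-zero u n))
    (solve 3 (λ u e g → e := e :+ u :* g :+ u :* (:- g)) R.refl u (E u n) (G u (suc n)))
  E±-step u (suc m) (suc n) = E±-step u m n

  G±-step : ∀ u m n → G± u (suc m) n ≋ G± u m (suc n) + E± u m n
  -- At index 0 the recurrence reads `1 = - 1 + 2`; here the value 2 of `E u 0` enters.
  G±-step u zero    zero    =
    solve 0 (con (+ 1) := :- con (+ 1) :+ con (+ 2)) R.refl
  G±-step u (suc m) zero    = R.refl
  G±-step u zero    (suc n) = R.trans (G±-zero u n)
    (solve 2 (λ g e → :- g := :- (g :+ e) :+ e) R.refl (G u n) (E u (suc n)))
  G±-step u (suc m) (suc n) = G±-step u m n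

  -- The explicit solution of the equations.

  module Solution (u : Carrier) (s : ℕ) where

    -- The weights of the symmetric and antisymmetric parts, chosen so that the
    -- empty prefix sum Σ 0 (s + 2) vanishes: see Σ-start.
    X Y : Carrier
    X = E (- u) (suc (suc s))
    Y = G u (suc (suc s))

    -- V (2c + 1) s is w (s - c), and Σ (2c) s is the sum of w 0, …, w c.
    V W Σ : ℕ → ℕ → Carrier
    V m n = X * E± u m n + u * (Y * G± (- u) m n)
    W m n = X * E± u m n + - (u * (Y * G± (- u) m n))
    Σ m n = X * G± u m n + Y * E± (- u) m n

    -- Combines the step of `G` at `u` with that of `E` at `- u`; the latter gives the minus sign in
    -- `W`.
    Σ-step : ∀ m n → Σ (suc m) n ≋ Σ m (suc n) + W m n
    Σ-step m n = R.trans
      (R.+-cong (R.*-congˡ (G±-step u m n)) (R.*-congˡ (E±-step (- u) m n)))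
      (solve 7 (λ u x y g e e′ g′ →
        x :* (g :+ e) :+ y :* (e′ :+ (:- u) :* g′) :=
        x :* g :+ y :* e′ :+ (x :* e :+ :- (u :* (y :* g′)))) R.refl
        u X Y (G± u m (suc n)) (E± u m n) (E± (- u) m (suc n)) (G± (- u) m n))

    V-step : ∀ m n → V (suc m) n ≋ V m (suc n) + u * Σ m n
    V-step m n = R.trans
      (R.+-cong (R.*-congˡ (E±-step u m n)) (R.*-congˡ (R.*-congˡ (G±-step (- u) m n))))
      (solve 7 (λ u x y e g g′ e′ →
        x :* (e :+ u :* g) :+ u :* (y :* (g′ :+ e′)) :=
        x :* e :+ u :* (y :* g′) :+ u :* (x :* g :+ y :* e′)) R.refl
        u X Y (E± u m (suc n)) (G± u m n) (G± (- u) m (suc n)) (E± (- u) m n))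

    -- Exchanging `m` and `n` reflects about the centre: the part in `E` is kept, the part in `G`
    -- changes sign.
    W≋V : ∀ m n → W m n ≋ V n m
    W≋V m n = R.+-cong (R.*-congˡ (R.reflexive (E±-sym u m n)))
      (R.trans (R.-‿cong (R.*-congˡ (R.*-congˡ (G±-antisym (- u) m n))))
        (solve 3 (λ u y g → :- (u :* (y :* (:- g))) := u :* (y :* g)) R.refl
          u Y (G± (- u) n m)))

    -- Indices are doubled to make room for half steps: the sum up to `c` sits at difference
    -- `2c - s`, midway between `w c` at `2c - s - 1` and `w (c + 1)` at `2c - s + 1`.
    w : ℕ → Carrier
    w a = W (a ℕ.+ a) (suc s)

    Σ-start : Σ 0 (suc (suc s)) ≋ const (+ 0)
    Σ-start = solve 2 (λ x y → x :* (:- y) :+ y :* x := con (+ 0)) R.refl X Y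

    prefixSums-w : ∀ c → prefixSums _+_ w c ≋ Σ (c ℕ.+ c) s
    prefixSums-w zero    = R.sym (R.trans (Σ-step 0 (suc s)) (R.trans (R.+-congʳ Σ-start)
      (solve 1 (λ a → con (+ 0) :+ a := a) R.refl (w 0))))
    prefixSums-w (suc c) = R.trans (R.+-congʳ (prefixSums-w c)) (lemma (ℕ.+-suc c c))
      where
      lemma : ∀ {k} → k ≡ suc (c ℕ.+ c) → Σ (c ℕ.+ c) s + W (suc k) (suc s) ≋ Σ (suc k) s
      -- With `k` replaced, matching successors cancel by computation and the step reads
      -- `Σ (2c) s + w (c + 1) = Σ (2c + 2) s`.
      lemma refl = R.sym (Σ-step (suc (suc (c ℕ.+ c))) (suc s))

    -- This is `w` extrapolated to `s + 1`, where the double prefix sum is empty, so it serves as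
    -- the inhomogeneous term of the equations.
    V-start : V 0 (suc s) ≋ 2Q u (- u) s
    V-start = solve 5 (λ u x y e g →
        x :* e :+ u :* (y :* (:- g)) := x :* e :+ :- (u :* (y :* g)))
      R.refl u X Y (E u (suc s)) (G (- u) (suc s))

    prefixSums²-w : ∀ c →
      2Q u (- u) s + u * prefixSums _+_ (prefixSums _+_ w) c ≋ V (suc (c ℕ.+ c)) s
    prefixSums²-w zero    = R.trans
      (R.+-cong (R.sym V-start) (R.*-congˡ (prefixSums-w 0))) (R.sym (V-step 0 s))
    prefixSums²-w (suc c) = R.trans
      (solve 4 (λ q u a b → q :+ u :* (a :+ b) := q :+ u :* a :+ u :* b) R.refl
        (2Q u (- u) s) u (prefixSums _+_ (prefixSums _+_ w) c) (prefixSums _+_ w (suc c)))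
      (R.trans (R.+-cong (prefixSums²-w c) (R.*-congˡ (prefixSums-w (suc c))))
        (lemma (ℕ.+-suc c c)))
      where
      lemma : ∀ {k} → k ≡ suc (c ℕ.+ c) →
              V (suc (c ℕ.+ c)) s + u * Σ (suc k) s ≋ V (suc (suc k)) s
      lemma refl = R.sym (V-step (suc (suc (c ℕ.+ c))) s)

    -- After reflection both sides are `V` at index difference `c + 1 - a`, and `V` depends only on
    -- that difference.
    w-fixed : ∀ a c → a ℕ.+ c ≡ s →
      w a ≋ 2Q u (- u) s + u * prefixSums _+_ (prefixSums _+_ w) c
    w-fixed a c refl = R.trans (W≋V (a ℕ.+ a) (suc (a ℕ.+ c)))
      (R.trans (R.reflexive (trans (lemma (ℕ.+-suc a c) refl)
                 (sym (lemma (ℕ.+-suc c c) (ℕ.+-comm c a)))))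
               (R.sym (prefixSums²-w c)))
      where
      V-+ : ∀ k m n → V (k ℕ.+ m) (k ℕ.+ n) ≡ V m n
      V-+ k m n = cong₂ (λ e g → X * e + u * (Y * g)) (E±-+ u k m n) (G±-+ (- u) k m n)

      lemma : ∀ {k i j} → k ℕ.+ suc c ≡ i → k ℕ.+ a ≡ j → V i j ≡ V (suc c) a
      lemma {k} refl refl = V-+ k (suc c) a

    prefixSums-w-total : prefixSums _+_ w s ≋ 2P u (- u) s
    prefixSums-w-total = R.trans (prefixSums-w s) (R.reflexive (lemma (ℕ.+-identityʳ s)))
      where
      lemma : ∀ {k} → s ℕ.+ 0 ≡ k → Σ (s ℕ.+ s) k ≡ Σ s 0
      lemma refl = cong₂ (λ g e → X * g + Y * e) (G±-+ u s s 0) (E±-+ (- u) s s 0)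

-- The ring of formal power series.

infixl 6 _⊞_
infix  8 ⊟_

_⊞_ : PowerSeries → PowerSeries → PowerSeries
(f ⊞ g) n = f n ℤ.+ g n

⊟_ : PowerSeries → PowerSeries
(⊟ f) n = ℤ.- f n

const : ℤ → PowerSeries
const a = ⟦ a ∷ [] ⟧

y : PowerSeries
y = ⟦ 0ℤ ∷ 1ℤ ∷ [] ⟧

-- The product at `suc n` unfolds by computation to `f 0 * g (suc n) + (f ∘ suc ⊛ g) n`, so this and
-- the later ring laws go by induction on `n` with shifted factors.
⊛-cong : ∀ {f f′ g g′} → f ≈ f′ → g ≈ g′ → f ⊛ g ≈ f′ ⊛ g′
⊛-cong p q zero    = cong₂ (λ a b → a ℤ.* b ℤ.+ 0ℤ) (p 0) (q 0)
⊛-cong p q (suc n) =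
  cong₂ ℤ._+_ (cong₂ ℤ._*_ (p 0) (q (suc n))) (⊛-cong (p ∘ suc) q n)

const-⊛ : ∀ a g n → (const a ⊛ g) n ≡ a ℤ.* g n
const-⊛ a g zero    = ℤ.+-identityʳ _
const-⊛ a g (suc n) = trans (cong (ℤ._+_ (a ℤ.* g (suc n))) (lemma n)) (ℤ.+-identityʳ _)
  where
  lemma : ∀ n → (const a ∘ suc ⊛ g) n ≡ 0ℤ
  lemma zero    = refl
  lemma (suc n) = cong₂ ℤ._+_ (ℤ.*-zeroˡ (g (suc n))) (lemma n)

one≈const : one ≈ const 1ℤ
one≈const zero    = refl
one≈const (suc n) = refl

⊛-identityˡ : ∀ f → one ⊛ f ≈ f
⊛-identityˡ f n =
  trans (⊛-cong {g = f} one≈const (λ _ → refl) n) (trans (const-⊛ 1ℤ f n) (ℤ.*-identityˡ _))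

y-⊛-suc : ∀ f n → (y ⊛ f) (suc n) ≡ f n
y-⊛-suc f n =
  trans (ℤ.+-identityˡ _) (trans (const-⊛ 1ℤ f n) (ℤ.*-identityˡ _))

⊛-distribʳ : ∀ h f g → (f ⊞ g) ⊛ h ≈ (f ⊛ h) ⊞ (g ⊛ h)
⊛-distribʳ h f g zero    = ℤ.+-*-Solver.solve 3
  (λ a b c → (a :+ b) :* c :+ con 0ℤ := a :* c :+ con 0ℤ :+ (b :* c :+ con 0ℤ))
  refl (f 0) (g 0) (h 0)
  where open ℤ.+-*-Solver
⊛-distribʳ h f g (suc n) = trans
  (cong (ℤ._+_ ((f 0 ℤ.+ g 0) ℤ.* h (suc n))) (⊛-distribʳ h (f ∘ suc) (g ∘ suc) n))
  (ℤ.+-*-Solver.solve 5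
    (λ a b c d e → (a :+ b) :* c :+ (d :+ e) := (a :* c :+ d) :+ (b :* c :+ e))
    refl (f 0) (g 0) (h (suc n)) ((f ∘ suc ⊛ h) n) ((g ∘ suc ⊛ h) n))
  where open ℤ.+-*-Solver

-- Splits off the last term where unfolding splits off the first; commutativity needs both.
⊛-suc : ∀ f g n → (f ⊛ g) (suc n) ≡ f (suc n) ℤ.* g 0 ℤ.+ (f ⊛ g ∘ suc) n
⊛-suc f g zero    = ℤ.+-*-Solver.solve 4
  (λ a b c d → a :* d :+ (b :* c :+ con 0ℤ) := b :* c :+ (a :* d :+ con 0ℤ))
  refl (f 0) (f 1) (g 0) (g 1)
  where open ℤ.+-*-Solver
⊛-suc f g (suc n) = trans
  (cong (ℤ._+_ (f 0 ℤ.* g (suc (suc n)))) (⊛-suc (f ∘ suc) g n))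
  (ℤ.+-*-Solver.solve 3 (λ a b c → a :+ (b :+ c) := b :+ (a :+ c))
    refl (f 0 ℤ.* g (suc (suc n))) (f (suc (suc n)) ℤ.* g 0) ((f ∘ suc ⊛ g ∘ suc) n))
  where open ℤ.+-*-Solver

⊛-comm : ∀ f g → f ⊛ g ≈ g ⊛ f
⊛-comm f g zero    = cong (ℤ._+ 0ℤ) (ℤ.*-comm (f 0) (g 0))
⊛-comm f g (suc n) = trans
  (cong₂ ℤ._+_ (ℤ.*-comm (f 0) (g (suc n))) (⊛-comm (f ∘ suc) g n))
  (sym (⊛-suc g f n))

const-⊛-assoc : ∀ a f g → (λ n → a ℤ.* f n) ⊛ g ≈ (λ n → a ℤ.* (f ⊛ g) n)
const-⊛-assoc a f g zero    = ℤ.+-*-Solver.solve 3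
  (λ a b c → a :* b :* c :+ con 0ℤ := a :* (b :* c :+ con 0ℤ)) refl a (f 0) (g 0)
  where open ℤ.+-*-Solver
const-⊛-assoc a f g (suc n) = trans
  (cong (ℤ._+_ (a ℤ.* f 0 ℤ.* g (suc n))) (const-⊛-assoc a (f ∘ suc) g n))
  (ℤ.+-*-Solver.solve 4 (λ a b c d → a :* b :* c :+ a :* d := a :* (b :* c :+ d))
    refl a (f 0) (g (suc n)) ((f ∘ suc ⊛ g) n))
  where open ℤ.+-*-Solver

⊛-assoc : ∀ f g h → (f ⊛ g) ⊛ h ≈ f ⊛ (g ⊛ h)
⊛-assoc f g h zero    = ℤ.+-*-Solver.solve 3
  (λ a b c → (a :* b :+ con 0ℤ) :* c :+ con 0ℤ := a :* (b :* c :+ con 0ℤ) :+ con 0ℤ)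
  refl (f 0) (g 0) (h 0)
  where open ℤ.+-*-Solver
⊛-assoc f g h (suc n) = begin
  (f ⊛ g) 0 ℤ.* h (suc n) ℤ.+ ((f ⊛ g) ∘ suc ⊛ h) n
    -- By computation `(f ⊛ g) ∘ suc` is the sum of `f 0` times `g ∘ suc` and `f ∘ suc ⊛ g`.
    ≡⟨ cong (ℤ._+_ ((f ⊛ g) 0 ℤ.* h (suc n)))
         (⊛-distribʳ h (λ k → f 0 ℤ.* g (suc k)) (f ∘ suc ⊛ g) n) ⟩
  (f ⊛ g) 0 ℤ.* h (suc n) ℤ.+
    (((λ k → f 0 ℤ.* g (suc k)) ⊛ h) n ℤ.+ ((f ∘ suc ⊛ g) ⊛ h) n)
    ≡⟨ cong (ℤ._+_ ((f ⊛ g) 0 ℤ.* h (suc n)))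
         (cong₂ ℤ._+_ (const-⊛-assoc (f 0) (g ∘ suc) h n) (⊛-assoc (f ∘ suc) g h n)) ⟩
  (f ⊛ g) 0 ℤ.* h (suc n) ℤ.+
    (f 0 ℤ.* (g ∘ suc ⊛ h) n ℤ.+ (f ∘ suc ⊛ (g ⊛ h)) n)
    ≡⟨ ℤ.+-*-Solver.solve 5
         (λ a b c d e → (a :* b :+ con 0ℤ) :* c :+ (a :* d :+ e) := a :* (b :* c :+ d) :+ e)
         refl (f 0) (g 0) (h (suc n)) ((g ∘ suc ⊛ h) n) ((f ∘ suc ⊛ (g ⊛ h)) n) ⟩
  f 0 ℤ.* (g ⊛ h) (suc n) ℤ.+ (f ∘ suc ⊛ (g ⊛ h)) n ∎
  where
  open ≡-Reasoning
  open ℤ.+-*-Solver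

powerSeriesRing : CommutativeRing 0ℓ 0ℓ
powerSeriesRing = record
  { Carrier = PowerSeries
  ; _≈_     = _≈_
  ; _+_     = _⊞_
  ; _*_     = _⊛_
  ; -_      = ⊟_
  ; 0#      = λ _ → 0ℤ
  ; 1#      = one
  ; isCommutativeRing = record
    { isRing = record
      { +-isAbelianGroup = Pointwise.isAbelianGroup ℕ ℤ.+-0-isAbelianGroup
      ; *-cong     = ⊛-cong
      ; *-assoc    = ⊛-assoc
      ; *-identity = ⊛-identityˡ , λ f n → trans (⊛-comm f one n) (⊛-identityˡ f n)
      ; distrib    =
          (λ f g h n → trans (⊛-comm f (g ⊞ h) n)
            (trans (⊛-distribʳ f g h n) (cong₂ ℤ._+_ (⊛-comm g f n) (⊛-comm h f n))))
        , ⊛-distribʳ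
      }
    ; *-comm = ⊛-comm
    }
  }

module PS = CommutativeRing powerSeriesRing

const-morphism :
  CommutativeRing.rawRing ℤ.+-*-commutativeRing -Raw-AlmostCommutative⟶
  fromCommutativeRing powerSeriesRing
const-morphism = record
  { ⟦_⟧    = const
  ; +-homo = λ { a b zero → refl ; a b (suc n) → refl }
  ; *-homo = λ a b n → sym (trans (const-⊛ a (const b) n) (lemma a b n))
  ; -‿homo = λ { a zero → refl ; a (suc n) → refl }
  ; 0-homo = λ { zero → refl ; (suc n) → refl }
  ; 1-homo = λ n → sym (one≈const n)
  }
  where
  lemma : ∀ a b n → a ℤ.* const b n ≡ const (a ℤ.* b) n
  lemma a b zero    = refl
  lemma a b (suc n) = ℤ.*-zeroʳ a

module Series = Polynomials powerSeriesRing const-morphism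
open Series using (eval; 2P; 2Q)
open Counting using (startingWith; startingWith-suc; h≡prefixSums)

eval-y : ∀ p → eval p y ≈ ⟦ p ⟧
eval-y []      zero    = refl
eval-y []      (suc n) = refl
eval-y (a ∷ p) zero    = ℤ.+-identityʳ a
eval-y (a ∷ p) (suc n) =
  trans (ℤ.+-identityˡ _) (trans (y-⊛-suc (eval p y) n) (eval-y p n))

-- Inverting series with constant term 1.

⊛-cong-≤ : ∀ f {g g′} n → (∀ i → i ≤ n → g i ≡ g′ i) → (f ⊛ g) n ≡ (f ⊛ g′) n
⊛-cong-≤ f zero    g≗g′ = cong (λ z → f 0 ℤ.* z ℤ.+ 0ℤ) (g≗g′ 0 z≤n)
⊛-cong-≤ f (suc n) g≗g′ = cong₂ (λ z x → f 0 ℤ.* z ℤ.+ x) (g≗g′ (suc n) ℕ.≤-refl)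
  (⊛-cong-≤ (f ∘ suc) n (λ i i≤n → g≗g′ i (ℕ.m≤n⇒m≤1+n i≤n)))

module Inverse (q : PowerSeries) (q₀≡1 : q 0 ≡ 1ℤ) where

  -- Stage `k` of solving for the inverse coefficient by coefficient; it is correct in coefficients
  -- `0, …, k`. Recursion on the stage is structural, although the product consumes a whole series.
  approx : ℕ → PowerSeries
  approx k       zero    = 1ℤ
  approx zero    (suc n) = 0ℤ
  approx (suc k) (suc n) = ℤ.- (q ∘ suc ⊛ approx k) n

  approx-suc : ∀ k n → n ≤ k → approx k n ≡ approx (suc k) n
  approx-suc k       zero    _         = refl
  approx-suc (suc k) (suc n) (s≤s n≤k) = cong ℤ.-_
    (⊛-cong-≤ (q ∘ suc) n (λ i i≤n → approx-suc k i (ℕ.≤-trans i≤n n≤k)))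

  approx-stable : ∀ d n → approx (d ℕ.+ n) n ≡ approx n n
  approx-stable zero    n = refl
  approx-stable (suc d) n =
    trans (sym (approx-suc (d ℕ.+ n) n (ℕ.m≤n+m n d))) (approx-stable d n)

  inverse : PowerSeries
  inverse n = approx n n

  inverseʳ : q ⊛ inverse ≈ one
  inverseʳ zero    = cong (λ z → z ℤ.* 1ℤ ℤ.+ 0ℤ) q₀≡1
  inverseʳ (suc n) = begin
    q 0 ℤ.* inverse (suc n) ℤ.+ (q ∘ suc ⊛ inverse) n
      ≡⟨ cong₂ ℤ._+_ (trans (cong (ℤ._* inverse (suc n)) q₀≡1) (ℤ.*-identityˡ _))
           (⊛-cong-≤ (q ∘ suc) n stable) ⟩
    ℤ.- (q ∘ suc ⊛ approx n) n ℤ.+ (q ∘ suc ⊛ approx n) n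
      ≡⟨ ℤ.+-inverseˡ ((q ∘ suc ⊛ approx n) n) ⟩
    0ℤ ∎
    where
    open ≡-Reasoning
    stable : ∀ i → i ≤ n → inverse i ≡ approx n i
    stable i i≤n = trans (sym (approx-stable (n ℕ.∸ i) i))
      (cong (λ k → approx k i) (ℕ.m∸n+n≡m i≤n))

⊛≈⇒≈÷ : ∀ f p q → q 0 ≡ 1ℤ → q ⊛ f ≈ p → f ≈ p ÷ q
⊛≈⇒≈÷ f p q q₀≡1 qf≈p = inverse , inverseʳ , λ n → begin
  f n                       ≡⟨ ⊛-identityˡ f n ⟨
  (one ⊛ f) n               ≡⟨ ⊛-cong {g = f} inverseʳ (λ _ → refl) n ⟨
  ((q ⊛ inverse) ⊛ f) n     ≡⟨ ⊛-cong {g = f} (⊛-comm q inverse) (λ _ → refl) n ⟩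
  ((inverse ⊛ q) ⊛ f) n     ≡⟨ ⊛-assoc inverse q f n ⟩
  (inverse ⊛ (q ⊛ f)) n     ≡⟨ ⊛-cong {f = inverse} (λ _ → refl) qf≈p n ⟩
  (inverse ⊛ p) n           ≡⟨ ⊛-comm inverse p n ⟩
  (p ⊛ inverse) n           ∎
  where
  open Inverse q q₀≡1
  open ≡-Reasoning

-- The terms with a factor `y` drop out of the recurrence, leaving `2 * 1 - 1 = 1`. This makes the
-- denominator invertible over ℤ.
Q-constant : ∀ n → eval (Q n) y 0 ≡ 1ℤ
Q-constant 0 = refl
Q-constant 1 = refl
Q-constant 2 = refl
Q-constant 3 = refl
Q-constant (suc (suc (suc (suc n)))) = trans
  (Series.eval-recurrence (Q (suc (suc (suc n)))) (Q (suc (suc n))) (Q (suc n)) (Q n) y 0)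
  (cong₂ (λ a b → 0ℤ ℤ.+ (+ 2 ℤ.* a ℤ.+ 0ℤ) ℤ.+ ℤ.- b)
    (Q-constant (suc (suc n))) (Q-constant n))

-- The fixed-point equations and the uniqueness of their solution.

IsSolution : ℕ → PowerSeries → (ℕ → PowerSeries) → Set
IsSolution s q F = ∀ a c → a ℕ.+ c ≡ s →
  F a ≈ q ⊞ y ⊛ prefixSums _⊞_ (prefixSums _⊞_ F) c

prefixSums-coefficient : ∀ F c n →
  prefixSums _⊞_ F c n ≡ prefixSums ℤ._+_ (λ a → F a n) c
prefixSums-coefficient F c n = prefixSums-homo _⊞_ ℤ._+_ (λ f → f n) (λ _ _ → refl) F c

prefixSums²-coefficient : ∀ F c n →
  prefixSums _⊞_ (prefixSums _⊞_ F) c n ≡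
  prefixSums ℤ._+_ (prefixSums ℤ._+_ (λ a → F a n)) c
prefixSums²-coefficient F c n = trans
  (prefixSums-coefficient (prefixSums _⊞_ F) c n)
  (prefixSums-cong c (λ j _ → prefixSums-coefficient F j n))

-- Because of the factor y, coefficient n + 1 of F a is determined by the
-- coefficients n of the F b with b ≤ s.
solution-unique : ∀ {s q F F′} → IsSolution s q F → IsSolution s q F′ →
  ∀ n a → a ≤ s → F a n ≡ F′ a n
solution-unique {s} {q} {F} {F′} sol sol′ n a a≤s = go n a (s ℕ.∸ a) (ℕ.m+[n∸m]≡n a≤s)
  where
  go : ∀ n a c → a ℕ.+ c ≡ s → F a n ≡ F′ a n
  go zero    a c e = trans (sol a c e 0) (sym (sol′ a c e 0))
  go (suc n) a c e = trans (step F sol) (trans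
    (cong (ℤ._+_ (q (suc n))) (prefixSums-cong c λ j j≤c → prefixSums-cong j λ b b≤j →
      go n b (s ℕ.∸ b) (ℕ.m+[n∸m]≡n (ℕ.≤-trans b≤j (ℕ.≤-trans j≤c c≤s)))))
    (sym (step F′ sol′)))
    where
    c≤s : c ≤ s
    c≤s = ℕ.≤-trans (ℕ.m≤n+m c a) (ℕ.≤-reflexive e)

    step : ∀ F → IsSolution s q F →
      F a (suc n) ≡ q (suc n) ℤ.+ prefixSums ℤ._+_ (prefixSums ℤ._+_ (λ b → F b n)) c
    step F sol = trans (sol a c e (suc n))
      (cong (ℤ._+_ (q (suc n))) (trans (y-⊛-suc (prefixSums _⊞_ (prefixSums _⊞_ F) c) n)
        (prefixSums²-coefficient F c n)))

⊛-prefixSums : ∀ q F c → q ⊛ prefixSums _⊞_ F c ≈ prefixSums _⊞_ (λ a → q ⊛ F a) c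
⊛-prefixSums q F c n = trans
  (prefixSums-homo _⊞_ ℤ._+_ (λ f → (q ⊛ f) n) (λ f g → PS.distribˡ q f g n) F c)
  (sym (prefixSums-coefficient (λ a → q ⊛ F a) c n))

-- The equations are linear: multiplication by `q` turns the term `one` into `q` and passes through
-- `y` and both prefix sums.
solution-scale : ∀ {s F} q → IsSolution s one F → IsSolution s q (λ a → q ⊛ F a)
solution-scale {s} {F} q sol a c e zero    = begin
  (q ⊛ F a) 0          ≡⟨ cong (λ z → q 0 ℤ.* z ℤ.+ 0ℤ) (sol a c e 0) ⟩
  q 0 ℤ.* 1ℤ ℤ.+ 0ℤ    ≡⟨ cong (ℤ._+ 0ℤ) (ℤ.*-identityʳ (q 0)) ⟩
  q 0 ℤ.+ 0ℤ           ∎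
  where open ≡-Reasoning
solution-scale {s} {F} q sol a c e n@(suc m) = begin
  (q ⊛ F a) n                         ≡⟨ ⊛-cong {f = q} (λ _ → refl) (sol a c e) n ⟩
  (q ⊛ (one ⊞ y ⊛ SSF)) n             ≡⟨ PS.distribˡ q one (y ⊛ SSF) n ⟩
  (q ⊛ one) n ℤ.+ (q ⊛ (y ⊛ SSF)) n
    ≡⟨ cong₂ ℤ._+_ (PS.*-identityʳ q n) (x∙yz≈y∙xz q y SSF n) ⟩
  q n ℤ.+ (y ⊛ (q ⊛ SSF)) n
    ≡⟨ cong (ℤ._+_ (q n)) (⊛-cong {f = y} (λ _ → refl) pushed n) ⟩
  q n ℤ.+ (y ⊛ prefixSums _⊞_ (prefixSums _⊞_ (λ b → q ⊛ F b)) c) n ∎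
  where
  open ≡-Reasoning
  open import Algebra.Properties.CommutativeSemigroup PS.*-commutativeSemigroup using (x∙yz≈y∙xz)
  SSF = prefixSums _⊞_ (prefixSums _⊞_ F) c

  pushed : q ⊛ SSF ≈ prefixSums _⊞_ (prefixSums _⊞_ (λ b → q ⊛ F b)) c
  pushed k = trans (⊛-prefixSums q (prefixSums _⊞_ F) c k) (trans
    (prefixSums-coefficient (λ j → q ⊛ prefixSums _⊞_ F j) c k) (trans
    (prefixSums-cong c (λ j _ → ⊛-prefixSums q F j k))
    (sym (prefixSums-coefficient (prefixSums _⊞_ (λ b → q ⊛ F b)) c k))))

-- The generating functions of labellings and the conclusion.

U : ℕ → ℕ → PowerSeries
U s a n = + startingWith s n a

-- Coefficient `suc n` is the transfer step `startingWith-suc`; at coefficient 0 both sides are 1.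
U-solution : ∀ s → IsSolution s one (U s)
U-solution s a c e    zero    = refl
U-solution s a c refl (suc n) = begin
  + startingWith s (suc n) a
    ≡⟨ cong +_ (startingWith-suc n a c) ⟩
  + prefixSums ℕ._+_ (prefixSums ℕ._+_ (startingWith s n)) c
    ≡⟨ prefixSums-homo ℕ._+_ ℤ._+_ +_ ℤ.pos-+ (prefixSums ℕ._+_ (startingWith s n)) c ⟩
  prefixSums ℤ._+_ (λ j → + prefixSums ℕ._+_ (startingWith s n) j) c
    ≡⟨ prefixSums-cong c (λ j _ → prefixSums-homo ℕ._+_ ℤ._+_ +_ ℤ.pos-+ (startingWith s n) j) ⟩
  prefixSums ℤ._+_ (prefixSums ℤ._+_ (λ b → U s b n)) c
    ≡⟨ prefixSums²-coefficient (U s) c n ⟨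
  prefixSums _⊞_ (prefixSums _⊞_ (U s)) c n
    ≡⟨ y-⊛-suc (prefixSums _⊞_ (prefixSums _⊞_ (U s)) c) n ⟨
  (y ⊛ prefixSums _⊞_ (prefixSums _⊞_ (U s)) c) (suc n)
    ≡⟨ ℤ.+-identityˡ _ ⟨
  0ℤ ℤ.+ (y ⊛ prefixSums _⊞_ (prefixSums _⊞_ (U s)) c) (suc n) ∎
  where open ≡-Reasoning

FL≈prefixSums : ∀ s → FL s ≈ prefixSums _⊞_ (U s) s
FL≈prefixSums s n = begin
  + h n s
    ≡⟨ cong +_ (h≡prefixSums n s) ⟩
  + prefixSums ℕ._+_ (startingWith s n) s
    ≡⟨ prefixSums-homo ℕ._+_ ℤ._+_ +_ ℤ.pos-+ (startingWith s n) s ⟩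
  prefixSums ℤ._+_ (λ a → U s a n) s
    ≡⟨ prefixSums-coefficient (U s) s n ⟨
  prefixSums _⊞_ (U s) s n ∎
  where open ≡-Reasoning

-- `q ⊛ U s a` and `w a` solve the same equations, hence agree for `a ≤ s`; it remains to sum over
-- `a`.
2Q-⊛-FL : ∀ s → 2Q y (⊟ y) s ⊛ FL s ≈ 2P y (⊟ y) s
2Q-⊛-FL s n = begin
  (q ⊛ FL s) n
    ≡⟨ ⊛-cong {f = q} (λ _ → refl) (FL≈prefixSums s) n ⟩
  (q ⊛ prefixSums _⊞_ (U s) s) n
    ≡⟨ prefixSums-homo _⊞_ ℤ._+_ (λ f → (q ⊛ f) n) (λ f g → PS.distribˡ q f g n) (U s) s ⟩
  prefixSums ℤ._+_ (λ a → (q ⊛ U s a) n) s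
    ≡⟨ prefixSums-cong s (solution-unique {q = q} (solution-scale q (U-solution s)) w-fixed n) ⟩
  prefixSums ℤ._+_ (λ a → w a n) s
    ≡⟨ prefixSums-coefficient w s n ⟨
  prefixSums _⊞_ w s n
    ≡⟨ prefixSums-w-total n ⟩
  2P y (⊟ y) s n ∎
  where
  open ≡-Reasoning
  open Series.Solution y s using (w; w-fixed; prefixSums-w-total)
  q = 2Q y (⊟ y) s

Q-⊛-FL : ∀ s → ⟦ Q s ⟧ ⊛ FL s ≈ ⟦ P s ⟧
-- The factor 2 carried by `2P` and `2Q` is cancelled in ℤ, one coefficient at a time.
Q-⊛-FL s n = ℤ.*-cancelˡ-≡ (+ 2) _ _ (begin
  + 2 ℤ.* (⟦ Q s ⟧ ⊛ FL s) n
    ≡⟨ const-⊛ (+ 2) (⟦ Q s ⟧ ⊛ FL s) n ⟨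
  (const (+ 2) ⊛ (⟦ Q s ⟧ ⊛ FL s)) n
    ≡⟨ ⊛-assoc (const (+ 2)) ⟦ Q s ⟧ (FL s) n ⟨
  (const (+ 2) ⊛ ⟦ Q s ⟧ ⊛ FL s) n
    ≡⟨ ⊛-cong {g = FL s} (double (Q s) (Series.2Q-correct s y)) (λ _ → refl) n ⟩
  (2Q y (⊟ y) s ⊛ FL s) n
    ≡⟨ 2Q-⊛-FL s n ⟩
  2P y (⊟ y) s n
    ≡⟨ double (P s) (Series.2P-correct s y) n ⟨
  (const (+ 2) ⊛ ⟦ P s ⟧) n
    ≡⟨ const-⊛ (+ 2) ⟦ P s ⟧ n ⟩
  + 2 ℤ.* ⟦ P s ⟧ n ∎)
  where
  open ≡-Reasoning
  double : ∀ p {f} → const (+ 2) ⊛ eval p y ≈ f → const (+ 2) ⊛ ⟦ p ⟧ ≈ f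
  double p e k =
    trans (⊛-cong {f = const (+ 2)} (λ _ → refl) (λ i → sym (eval-y p i)) k) (e k)

theorem1p3 : (s : ℕ) .{{_ : NonZero s}} → FL s ≈ ⟦ P s ⟧ ÷ ⟦ Q s ⟧
theorem1p3 s = ⊛≈⇒≈÷ (FL s) ⟦ P s ⟧ ⟦ Q s ⟧
  (trans (sym (eval-y (Q s) 0)) (Q-constant s)) (Q-⊛-FL s)
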